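{- Let $G$ be a $C_{4k}$-free bipartite graph and let $v\in V(G)$. Then $v\in \operatorname{Supp}(G)$ if and only if there exists a maximum matching $M$ of $G$ such that $v$ is not saturated by $M$ (i.e. $v$ lies in no edge of $M$).
   Context: All graphs are finite, simple and undirected. A graph is a $C_{4k}$-free bipartite graph if it is bipartite and contains no cycle whose length is a multiple of $4$. For a graph $G$, $A(G)$ is its adjacency matrix and $\operatorname{Null}(G)=\{\vec{x}\in\mathbb{R}^{V(G)} : A(G)\vec{x}=0\}$. The support $\operatorname{Supp}(G)$ is the set of vertices $v$ such that $\vec{x}_v\neq 0$ for some $\vec{x}\in\operatorname{Null}(G)$.
   Formalization: The null space Null(G) and the support Supp(G) are taken over ℚ instead of ℝ. -}

module Defs where

open import Data.Nat using (ℕ; zero; suc; _≤_)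
open import Data.Fin using (Fin; zero; suc; toℕ)
open import Data.Bool using (Bool; true; false; if_then_else_)
open import Data.Rational using (ℚ; 0ℚ; 1ℚ; _+_; _*_)
open import Data.Product using (Σ; ∃; _×_; _,_)
open import Data.List using (List; []; _∷_; concatMap; length)
open import Data.List.Relation.Unary.All using (All)
open import Data.List.Relation.Unary.Unique.Propositional using (Unique)
open import Data.List.Membership.Propositional using (_∈_)
open import Relation.Binary.PropositionalEquality using (_≡_; _≢_)
open import Function.Definitions using (Injective)

-- A finite simple graph on vertex set Fin n, given by a symmetric,
-- irreflexive (Boolean) adjacency relation.
record Graph (n : ℕ) : Set where
  field
    adj    : Fin n → Fin n → Bool
    adj-sym    : ∀ u v → adj u v ≡ adj v u
    adj-irrefl : ∀ v → adj v v ≡ false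
open Graph public

Adj : ∀ {n} → Graph n → Fin n → Fin n → Set
Adj G u v = adj G u v ≡ true

-- Bipartite: there is a proper 2-colouring.
Bipartite : ∀ {n} → Graph n → Set
Bipartite {n} G = Σ (Fin n → Bool) λ c → ∀ u v → Adj G u v → c u ≢ c v

-- A cycle of length L: L ≥ 3 pairwise distinct vertices f 0, …, f (L-1)
-- with f i ~ f (i+1) and f (L-1) ~ f 0.
IsCycle : ∀ {n} → Graph n → (L : ℕ) → (Fin L → Fin n) → Set
IsCycle G L f =
  (3 ≤ L)
  × Injective _≡_ _≡_ f
  × (∀ i j → suc (toℕ i) ≡ toℕ j → Adj G (f i) (f j))
  × (∀ i j → toℕ i ≡ 0 → suc (toℕ j) ≡ L → Adj G (f j) (f i))

-- C_{4k}-free: no cycle whose length is a multiple of 4.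
open import Data.Nat.Divisibility using (_∣_)
open import Relation.Nullary using (¬_)

C4kFree : ∀ {n} → Graph n → Set
C4kFree {n} G = ∀ (L : ℕ) (f : Fin L → Fin n) → IsCycle G L f → ¬ (4 ∣ L)

-- Adjacency matrix entries (over ℚ).
A : ∀ {n} → Graph n → Fin n → Fin n → ℚ
A G i j = if adj G i j then 1ℚ else 0ℚ

sumℚ : ∀ {n} → (Fin n → ℚ) → ℚ
sumℚ {zero}  f = 0ℚ
sumℚ {suc n} f = f zero + sumℚ (λ i → f (suc i))

-- Null(G) = { x | A(G) x = 0 }
InNull : ∀ {n} → Graph n → (Fin n → ℚ) → Set
InNull G x = ∀ i → sumℚ (λ j → A G i j * x j) ≡ 0ℚ

-- Supp(G)
InSupp : ∀ {n} → Graph n → Fin n → Set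
InSupp {n} G v = Σ (Fin n → ℚ) λ x → InNull G x × x v ≢ 0ℚ

-- Matchings: lists of edges (u , v) of G whose endpoints are all distinct.
endpoints : ∀ {n} → List (Fin n × Fin n) → List (Fin n)
endpoints = concatMap (λ { (u , v) → u ∷ v ∷ [] })

IsMatching : ∀ {n} → Graph n → List (Fin n × Fin n) → Set
IsMatching G M = All (λ { (u , v) → Adj G u v }) M × Unique (endpoints M)

IsMaximumMatching : ∀ {n} → Graph n → List (Fin n × Fin n) → Set
IsMaximumMatching G M =
  IsMatching G M × (∀ M′ → IsMatching G M′ → length M′ ≤ length M)

Saturates : ∀ {n} → List (Fin n × Fin n) → Fin n → Set
Saturates M v = v ∈ endpoints M

{-# OPTIONS --safe #-}

-- Let x ∈ Null(G) and let M be a matching. If x_u ≠ 0 and u is matched to w, the equation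
-- (A x)_w = 0 yields a neighbour u′ of w at which x has the opposite sign. Iterating gives an
-- M-alternating walk along which the sign of x alternates. It cannot return to a vertex it has
-- already visited, because that would close a cycle whose length is divisible by 4. So the walk
-- ends at an unsaturated vertex, and switching M along it frees u without changing |M|.
--
-- Conversely, suppose v ∉ Supp(G) while some maximum matching M misses v. By the Fredholm
-- alternative (A is symmetric), A y = e_v has a solution. Row v gives a neighbour t of v with
-- y_t ≠ 0. The rows at the mates of the vertices on t's side vanish because v is unsaturated, so
-- the same walk frees t and leaves v unsaturated. Adding the edge v t then contradicts
-- maximality.

module Submission where

open import Defs
open import Data.Nat using (ℕ)
open import Data.Fin using (Fin)
open import Data.Product using (Σ; _×_; _,_)
open import Data.List using (List)
open import Relation.Nullary using (¬_)
open import Function.Bundles using (_⇔_; mk⇔)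

open import Data.Bool as Bool using (Bool; true; false; not; if_then_else_)
open import Data.Bool.Properties using (¬-not; not-¬)
open import Data.Empty using (⊥; ⊥-elim)
open import Data.Fin as Fin using (zero; suc; toℕ)
open import Data.Fin.Permutation.Components using (transpose)
open import Data.Fin.Properties using (any?; suc-injective; injective⇒≤)
open import Data.List using ([]; _∷_; length; map; lookup; last; allFin; cartesianProduct; cartesianProductWith)
open import Data.List.Membership.Propositional using (_∈_; _∉_; find; lose)
open import Data.List.Membership.Propositional.Properties
  using ( ∈-map⁺; ∈-map⁻; ∈-lookup; ∈-allFin; ∈-cartesianProduct⁺
        ; ∈-cartesianProductWith⁺; ∈-cartesianProductWith⁻)
open import Data.List.Properties using (length-map)
open import Data.List.Relation.Unary.All as All using (All; []; _∷_)
open import Data.List.Relation.Unary.All.Properties using (¬Any⇒All¬) renaming (map⁺ to All-map⁺)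
open import Data.List.Relation.Unary.Any as Any using (here; there)
open import Data.List.Relation.Unary.Linked using (Linked; [-]; _∷_)
open import Data.List.Relation.Unary.Unique.Propositional using (Unique; []; _∷_)
import Data.List.Relation.Unary.Unique.Propositional.Properties as Unique
open import Data.Maybe using (just)
open import Data.Nat as ℕ using (zero; suc)
open import Data.Nat.Divisibility using (_∣_; ∣-refl; ∣m∣n⇒∣m+n; ∣⇒≤)
import Data.Nat.Properties as ℕ
open import Data.Product using (∃; proj₁; proj₂)
open import Data.Rational using (ℚ; 0ℚ; 1ℚ; _+_; _*_; -_; _-_; _<_; _≤_; 1/_; NonZero; ≢-nonZero)
import Data.Rational.Properties as ℚ
open import Data.Rational.Solver using (module +-*-Solver)
open import Data.Sign as Sign using (Sign; opposite)
open import Data.Sign.Properties using (opposite-involutive)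
open import Data.Sum as Sum using (_⊎_; inj₁; inj₂)
open import Data.Unit using (⊤; tt)
import Data.Vec.Functional as Vector
open import Function using (_∘_)
open import Function.Definitions using (Injective)
open import Relation.Binary.Definitions using (tri<; tri≈; tri>)
open import Relation.Binary.PropositionalEquality
open import Relation.Nullary using (Dec; yes; no; ¬?)
open import Relation.Nullary.Decidable using (decidable-stable; _×-dec_)
open import Relation.Unary using (Decidable)

open import Algebra.Properties.Group ℚ.+-0-group using () renaming (⁻¹-involutive to neg-involutive)
open +-*-Solver using (solve; _:=_; _:+_; _:*_; :-_; _:-_; con)

-- Finite sums and signs over ℚ

sumℚ-cong : ∀ {n} {f g : Fin n → ℚ} → (∀ i → f i ≡ g i) → sumℚ f ≡ sumℚ g
sumℚ-cong {zero}  f≗g = refl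
sumℚ-cong {suc n} f≗g = cong₂ _+_ (f≗g zero) (sumℚ-cong (f≗g ∘ suc))

sumℚ-zero : ∀ {n} {f : Fin n → ℚ} → (∀ i → f i ≡ 0ℚ) → sumℚ f ≡ 0ℚ
sumℚ-zero {zero}  f≗0 = refl
sumℚ-zero {suc n} f≗0 = cong₂ _+_ (f≗0 zero) (sumℚ-zero (f≗0 ∘ suc))

sumℚ-+-* : ∀ {n} (f g : Fin n → ℚ) c → sumℚ (λ i → f i + c * g i) ≡ sumℚ f + c * sumℚ g
sumℚ-+-* {zero}  f g c = solve 1 (λ c → con 0ℚ := con 0ℚ :+ c :* con 0ℚ) refl c
sumℚ-+-* {suc n} f g c = begin
  (f zero + c * g zero) + sumℚ (λ i → f (suc i) + c * g (suc i))
    ≡⟨ cong (f zero + c * g zero +_) (sumℚ-+-* (f ∘ suc) (g ∘ suc) c) ⟩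
  (f zero + c * g zero) + (sumℚ (f ∘ suc) + c * sumℚ (g ∘ suc))
    ≡⟨ solve 5 (λ a b c d e → (a :+ c :* b) :+ (d :+ c :* e) := (a :+ d) :+ c :* (b :+ e))
             refl (f zero) (g zero) c (sumℚ (f ∘ suc)) (sumℚ (g ∘ suc)) ⟩
  (f zero + sumℚ (f ∘ suc)) + c * (g zero + sumℚ (g ∘ suc)) ∎
  where open ≡-Reasoning

sumℚ-single : ∀ {n} (f : Fin n → ℚ) j → (∀ i → i ≢ j → f i ≡ 0ℚ) → sumℚ f ≡ f j
sumℚ-single f zero    f≗0 = trans (cong (f zero +_) (sumℚ-zero (λ i → f≗0 (suc i) λ ()))) (ℚ.+-identityʳ _)
sumℚ-single f (suc j) f≗0 =
  trans (cong₂ _+_ (f≗0 zero λ ()) (sumℚ-single (f ∘ suc) j (λ i i≢j → f≗0 (suc i) (i≢j ∘ suc-injective))))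
        (ℚ.+-identityˡ _)

sumℚ-neg : ∀ {n} (f : Fin n → ℚ) → sumℚ (λ i → - f i) ≡ - sumℚ f
sumℚ-neg {zero}  f = refl
sumℚ-neg {suc n} f = trans (cong (- f zero +_) (sumℚ-neg (f ∘ suc))) (sym (ℚ.neg-distrib-+ (f zero) _))

sumℚ-nonneg : ∀ {n} (f : Fin n → ℚ) → (∀ i → 0ℚ ≤ f i) → 0ℚ ≤ sumℚ f
sumℚ-nonneg {zero}  f 0≤f = ℚ.≤-refl
sumℚ-nonneg {suc n} f 0≤f = ℚ.+-mono-≤ (0≤f zero) (sumℚ-nonneg (f ∘ suc) (0≤f ∘ suc))

term≤sumℚ : ∀ {n} (f : Fin n → ℚ) → (∀ i → 0ℚ ≤ f i) → ∀ u → f u ≤ sumℚ f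
term≤sumℚ f 0≤f zero    = subst (_≤ sumℚ f) (ℚ.+-identityʳ (f zero))
                                (ℚ.+-mono-≤ (ℚ.≤-refl {f zero}) (sumℚ-nonneg (f ∘ suc) (0≤f ∘ suc)))
term≤sumℚ f 0≤f (suc u) = subst (_≤ sumℚ f) (ℚ.+-identityˡ _)
                                (ℚ.+-mono-≤ (0≤f zero) (term≤sumℚ (f ∘ suc) (0≤f ∘ suc) u))

sumℚ≢0⇒term≢0 : ∀ {n} (f : Fin n → ℚ) → sumℚ f ≢ 0ℚ → ∃ λ t → f t ≢ 0ℚ
sumℚ≢0⇒term≢0 f sum≢0 with any? (λ t → ¬? (f t ℚ.≟ 0ℚ))
... | yes found = found
... | no  none  = ⊥-elim (sum≢0 (sumℚ-zero f≗0))
  where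
  f≗0 : ∀ i → f i ≡ 0ℚ
  f≗0 i = decidable-stable (f i ℚ.≟ 0ℚ) (λ fi≢0 → none (i , fi≢0))

HasSign : Sign → ℚ → Set
HasSign Sign.+ x = 0ℚ < x
HasSign Sign.- x = x < 0ℚ

HasSign⇒≢0 : ∀ {s x} → HasSign s x → x ≢ 0ℚ
HasSign⇒≢0 {Sign.+} 0<x refl = ℚ.<-irrefl refl 0<x
HasSign⇒≢0 {Sign.-} x<0 refl = ℚ.<-irrefl refl x<0

≢0⇒HasSign : ∀ {x} → x ≢ 0ℚ → ∃ λ s → HasSign s x
≢0⇒HasSign {x} x≢0 with ℚ.<-cmp x 0ℚ
... | tri< x<0 _ _ = Sign.- , x<0
... | tri≈ _ x≡0 _ = ⊥-elim (x≢0 x≡0)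
... | tri> _ _ 0<x = Sign.+ , 0<x

HasSign-opposite⇒⊥ : ∀ {s x} → HasSign s x → HasSign (opposite s) x → ⊥
HasSign-opposite⇒⊥ {Sign.+} 0<x x<0 = ℚ.<-asym 0<x x<0
HasSign-opposite⇒⊥ {Sign.-} x<0 0<x = ℚ.<-asym 0<x x<0

HasSign-neg : ∀ {s x} → HasSign s x → HasSign (opposite s) (- x)
HasSign-neg {Sign.+} 0<x = ℚ.neg-antimono-< 0<x
HasSign-neg {Sign.-} x<0 = ℚ.neg-antimono-< x<0

positive-term⇒negative-term : ∀ {n} (f : Fin n → ℚ) → sumℚ f ≡ 0ℚ →
                              ∀ u → 0ℚ < f u → ∃ λ t → f t < 0ℚ
positive-term⇒negative-term f sum≡0 u 0<fu with any? (λ t → f t ℚ.<? 0ℚ)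
... | yes found = found
... | no  none  = ⊥-elim (ℚ.<-irrefl refl (ℚ.<-≤-trans 0<fu (subst (f u ≤_) sum≡0 fu≤sum)))
  where
  fu≤sum : f u ≤ sumℚ f
  fu≤sum = term≤sumℚ f (λ i → ℚ.≮⇒≥ (λ fi<0 → none (i , fi<0))) u

sumℚ≡0⇒opposite-term : ∀ {n} (f : Fin n → ℚ) → sumℚ f ≡ 0ℚ →
                       ∀ {s} u → HasSign s (f u) → ∃ λ t → HasSign (opposite s) (f t)
sumℚ≡0⇒opposite-term f sum≡0 {Sign.+} u 0<fu = positive-term⇒negative-term f sum≡0 u 0<fu
sumℚ≡0⇒opposite-term f sum≡0 {Sign.-} u fu<0
  with positive-term⇒negative-term (-_ ∘ f) (trans (sumℚ-neg f) (cong -_ sum≡0)) u (HasSign-neg {Sign.-} fu<0)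
... | t , -ft<0 = t , subst (0ℚ <_) (neg-involutive (f t)) (HasSign-neg { Sign.- } -ft<0)

-- The Fredholm alternative over ℚ

infix 7 _·_

_·_ : ∀ {n} → (Fin n → ℚ) → (Fin n → ℚ) → ℚ
x · y = sumℚ (λ k → x k * y k)

δ : ∀ {n} → Fin n → Fin n → ℚ
δ j k with k Fin.≟ j
... | yes _ = 1ℚ
... | no  _ = 0ℚ

δ-diag : ∀ {n} (j : Fin n) → δ j j ≡ 1ℚ
δ-diag j with j Fin.≟ j
... | yes _   = refl
... | no  j≢j = ⊥-elim (j≢j refl)

δ-off : ∀ {n} {j k : Fin n} → k ≢ j → δ j k ≡ 0ℚ
δ-off {j = j} {k} k≢j with k Fin.≟ j
... | yes k≡j = ⊥-elim (k≢j k≡j)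
... | no  _   = refl

·-comm : ∀ {n} (x y : Fin n → ℚ) → x · y ≡ y · x
·-comm x y = sumℚ-cong (λ k → ℚ.*-comm (x k) (y k))

·-δ : ∀ {n} (v : Fin n → ℚ) j → v · δ j ≡ v j
·-δ v j = trans (sumℚ-single _ j (λ k k≢j → trans (cong (v k *_) (δ-off k≢j)) (ℚ.*-zeroʳ (v k))))
                (trans (cong (v j *_) (δ-diag j)) (ℚ.*-identityʳ (v j)))

·-linearˡ : ∀ {n} (f g y : Fin n → ℚ) c → (λ k → f k + c * g k) · y ≡ f · y + c * (g · y)
·-linearˡ f g y c = trans (sumℚ-cong distrib) (sumℚ-+-* (λ k → f k * y k) (λ k → g k * y k) c)
  where
  distrib : ∀ k → (f k + c * g k) * y k ≡ f k * y k + c * (g k * y k)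
  distrib k = solve 4 (λ f g y c → (f :+ c :* g) :* y := f :* y :+ c :* (g :* y)) refl (f k) (g k) (y k) c

·-linearʳ : ∀ {n} (v y z : Fin n → ℚ) c → v · (λ k → y k + c * z k) ≡ v · y + c * (v · z)
·-linearʳ v y z c = trans (sumℚ-cong distrib) (sumℚ-+-* (λ k → v k * y k) (λ k → v k * z k) c)
  where
  distrib : ∀ k → v k * (y k + c * z k) ≡ v k * y k + c * (v k * z k)
  distrib k = solve 4 (λ v y z c → v :* (y :+ c :* z) := v :* y :+ c :* (v :* z)) refl (v k) (y k) (z k) c

Solution : ∀ {m n} → (Fin m → Fin n → ℚ) → (Fin m → ℚ) → Set
Solution {n = n} R b = Σ (Fin n → ℚ) λ y → ∀ i → R i · y ≡ b i

Obstruction : ∀ {m n} → (Fin m → Fin n → ℚ) → (Fin m → ℚ) → Set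
Obstruction {m} R b = Σ (Fin m → ℚ) λ l → (∀ k → l · (λ i → R i k) ≡ 0ℚ) × l · b ≢ 0ℚ

module _ {m n} (R : Fin (suc m) → Fin n → ℚ) (b : Fin (suc m) → ℚ) where

  extend-obstruction : Obstruction (R ∘ suc) (b ∘ suc) → Obstruction R b
  extend-obstruction (l , l⊥R , l·b≢0) = 0ℚ Vector.∷ l , l⊥R′ , l·b≢0 ∘ trans (sym l·b≡)
    where
    l⊥R′ : ∀ k → (0ℚ Vector.∷ l) · (λ i → R i k) ≡ 0ℚ
    l⊥R′ k = trans (cong₂ _+_ (ℚ.*-zeroˡ (R zero k)) (l⊥R k)) (ℚ.+-identityʳ 0ℚ)
    l·b≡ : (0ℚ Vector.∷ l) · b ≡ l · (b ∘ suc)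
    l·b≡ = trans (cong (_+ l · (b ∘ suc)) (ℚ.*-zeroˡ (b zero))) (ℚ.+-identityˡ _)

  module ZeroFirstRow (R₀≡0 : ∀ k → R zero k ≡ 0ℚ) where

    first-unit-obstruction : b zero ≢ 0ℚ → Obstruction R b
    first-unit-obstruction b₀≢0 = δ zero , δ₀⊥R , b₀≢0 ∘ trans (sym (δ₀· b))
      where
      δ₀· : ∀ v → δ zero · v ≡ v zero
      δ₀· v = trans (·-comm (δ zero) v) (·-δ v zero)
      δ₀⊥R : ∀ k → δ zero · (λ i → R i k) ≡ 0ℚ
      δ₀⊥R k = trans (δ₀· (λ i → R i k)) (R₀≡0 k)

    extend-solution : b zero ≡ 0ℚ → Solution (R ∘ suc) (b ∘ suc) → Solution R b
    extend-solution b₀≡0 (y , Ry≡b) = y , λ where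
      zero    → trans (sumℚ-zero (λ k → trans (cong (_* y k) (R₀≡0 k)) (ℚ.*-zeroˡ (y k)))) (sym b₀≡0)
      (suc i) → Ry≡b i

  module Eliminate (j : Fin n) (pivot≢0 : R zero j ≢ 0ℚ) where

    instance
      _ : NonZero (R zero j)
      _ = ≢-nonZero pivot≢0

    a : Fin n → ℚ
    a = R zero

    β : ℚ
    β = b zero

    factor : Fin m → ℚ
    factor i = R (suc i) j * 1/ a j

    R′ : Fin m → Fin n → ℚ
    R′ i k = R (suc i) k - factor i * a k

    b′ : Fin m → ℚ
    b′ i = b (suc i) - factor i * β

    x*1/aj*aj : ∀ x → x * 1/ a j * a j ≡ x
    x*1/aj*aj x = begin
      x * 1/ a j * a j   ≡⟨ ℚ.*-assoc x (1/ a j) (a j) ⟩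
      x * (1/ a j * a j) ≡⟨ cong (x *_) (ℚ.*-inverseˡ (a j)) ⟩
      x * 1ℚ             ≡⟨ ℚ.*-identityʳ x ⟩
      x                  ∎
      where open ≡-Reasoning

    R≡R′+factor*a : ∀ i k → R (suc i) k ≡ R′ i k + factor i * a k
    R≡R′+factor*a i k = solve 2 (λ r x → r := (r :- x) :+ x) refl (R (suc i) k) (factor i * a k)

    b≡b′+β*factor : ∀ i → b (suc i) ≡ b′ i + β * factor i
    b≡b′+β*factor i = solve 3 (λ r f β → r := (r :- f :* β) :+ β :* f) refl (b (suc i)) (factor i) β

    module LiftSolution (y′ : Fin n → ℚ) (R′y′≡b′ : ∀ i → R′ i · y′ ≡ b′ i) where

      -- y′ is corrected along e_j so that the pivot row holds as well.
      t : ℚ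
      t = (β - a · y′) * 1/ a j

      y : Fin n → ℚ
      y k = y′ k + t * δ j k

      ·y : ∀ v → v · y ≡ v · y′ + t * v j
      ·y v = trans (·-linearʳ v y′ (δ j) t) (cong (λ x → v · y′ + t * x) (·-δ v j))

      pivot-row : a · y ≡ β
      pivot-row = begin
        a · y                 ≡⟨ ·y a ⟩
        a · y′ + t * a j      ≡⟨ cong (a · y′ +_) (x*1/aj*aj (β - a · y′)) ⟩
        a · y′ + (β - a · y′) ≡⟨ solve 2 (λ d β → d :+ (β :- d) := β) refl (a · y′) β ⟩
        β                     ∎
        where open ≡-Reasoning

      other-row : ∀ i → R (suc i) · y ≡ b (suc i)
      other-row i = begin
        R (suc i) · y
          ≡⟨ ·y (R (suc i)) ⟩
        R (suc i) · y′ + t * R (suc i) j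
          ≡⟨ cong₂ (λ d r → d + t * r) R₊y′≡ (sym (x*1/aj*aj (R (suc i) j))) ⟩
        (b′ i + f * (a · y′)) + t * (f * a j)
          ≡⟨ solve 5 (λ b f d t x → (b :+ f :* d) :+ t :* (f :* x) := b :+ f :* (d :+ t :* x))
                   refl (b′ i) f (a · y′) t (a j) ⟩
        b′ i + f * (a · y′ + t * a j)
          ≡⟨ cong (λ x → b′ i + f * (a · y′ + x)) (x*1/aj*aj (β - a · y′)) ⟩
        b (suc i) - f * β + f * (a · y′ + (β - a · y′))
          ≡⟨ solve 4 (λ b f β d → b :- f :* β :+ f :* (d :+ (β :- d)) := b) refl (b (suc i)) f β (a · y′) ⟩
        b (suc i) ∎
        where
        open ≡-Reasoning
        f : ℚ
        f = factor i
        R₊y′≡ : R (suc i) · y′ ≡ b′ i + f * (a · y′)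
        R₊y′≡ = begin
          R (suc i) · y′                ≡⟨ sumℚ-cong (λ k → cong (_* y′ k) (R≡R′+factor*a i k)) ⟩
          (λ k → R′ i k + f * a k) · y′ ≡⟨ ·-linearˡ (R′ i) a y′ f ⟩
          R′ i · y′ + f * (a · y′)      ≡⟨ cong (_+ f * (a · y′)) (R′y′≡b′ i) ⟩
          b′ i + f * (a · y′)           ∎

    lift-solution : Solution R′ b′ → Solution R b
    lift-solution (y′ , R′y′≡b′) = y , Ry≡b
      where
      open LiftSolution y′ R′y′≡b′
      Ry≡b : ∀ i → R i · y ≡ b i
      Ry≡b zero    = pivot-row
      Ry≡b (suc i) = other-row i

    lift-obstruction : Obstruction R′ b′ → Obstruction R b
    lift-obstruction (l′ , l′⊥R′ , l′·b′≢0) = l , l⊥R , l′·b′≢0 ∘ trans (sym l·b≡l′·b′)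
      where
      S : ℚ
      S = l′ · factor
      l : Fin (suc m) → ℚ
      l = (- S) Vector.∷ l′
      l⊥R : ∀ k → l · (λ i → R i k) ≡ 0ℚ
      l⊥R k = begin
        - S * a k + l′ · (λ i → R (suc i) k)
          ≡⟨ cong (- S * a k +_) (sumℚ-cong (λ i → cong (l′ i *_) R₊≡)) ⟩
        - S * a k + l′ · (λ i → R′ i k + a k * factor i)
          ≡⟨ cong (- S * a k +_) (·-linearʳ l′ (λ i → R′ i k) factor (a k)) ⟩
        - S * a k + (l′ · (λ i → R′ i k) + a k * S)
          ≡⟨ cong (λ x → - S * a k + (x + a k * S)) (l′⊥R′ k) ⟩
        - S * a k + (0ℚ + a k * S)
          ≡⟨ solve 2 (λ S a → :- S :* a :+ (con 0ℚ :+ a :* S) := con 0ℚ) refl S (a k) ⟩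
        0ℚ ∎
        where
        open ≡-Reasoning
        R₊≡ : ∀ {i} → R (suc i) k ≡ R′ i k + a k * factor i
        R₊≡ {i} = trans (R≡R′+factor*a i k) (cong (R′ i k +_) (ℚ.*-comm (factor i) (a k)))
      l·b≡l′·b′ : l · b ≡ l′ · b′
      l·b≡l′·b′ = begin
        - S * β + l′ · (b ∘ suc)
          ≡⟨ cong (- S * β +_) (sumℚ-cong (λ i → cong (l′ i *_) (b≡b′+β*factor i))) ⟩
        - S * β + l′ · (λ i → b′ i + β * factor i)
          ≡⟨ cong (- S * β +_) (·-linearʳ l′ b′ factor β) ⟩
        - S * β + (l′ · b′ + β * S)
          ≡⟨ solve 3 (λ S β x → :- S :* β :+ (x :+ β :* S) := x) refl S β (l′ · b′) ⟩
        l′ · b′ ∎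
        where open ≡-Reasoning

fredholm : ∀ {m n} (R : Fin m → Fin n → ℚ) b → Solution R b ⊎ Obstruction R b
fredholm {zero}  R b = inj₁ ((λ _ → 0ℚ) , λ ())
fredholm {suc m} R b with any? (λ j → ¬? (R zero j ℚ.≟ 0ℚ))
... | yes (j , pivot≢0) = Sum.map lift-solution lift-obstruction (fredholm R′ b′)
  where open Eliminate R b j pivot≢0
... | no noPivot = zero-first-row (b zero ℚ.≟ 0ℚ)
  where
  open ZeroFirstRow R b (λ k → decidable-stable (R zero k ℚ.≟ 0ℚ) (λ Rk≢0 → noPivot (k , Rk≢0)))
  zero-first-row : Dec (b zero ≡ 0ℚ) → Solution R b ⊎ Obstruction R b
  zero-first-row (no  b₀≢0) = inj₂ (first-unit-obstruction b₀≢0)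
  zero-first-row (yes b₀≡0) =
    Sum.map (extend-solution b₀≡0) (extend-obstruction R b) (fredholm (R ∘ suc) (b ∘ suc))

-- Adjacency matrices

module _ {n} (G : Graph n) where

  Adj-sym : ∀ {u w} → Adj G u w → Adj G w u
  Adj-sym {u} {w} uw = trans (adj-sym G w u) uw

  Adj⇒≢ : ∀ {u w} → Adj G u w → u ≢ w
  Adj⇒≢ {u} uu refl with trans (sym uu) (adj-irrefl G u)
  ... | ()

  A-sym : ∀ u w → A G u w ≡ A G w u
  A-sym u w = cong (if_then 1ℚ else 0ℚ) (adj-sym G u w)

  A-Adj : ∀ {u w} → Adj G u w → A G u w ≡ 1ℚ
  A-Adj uw = cong (if_then 1ℚ else 0ℚ) uw

  A*≢0 : ∀ u t x → A G u t * x ≢ 0ℚ → Adj G u t × x ≢ 0ℚ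
  A*≢0 u t x A*x≢0 with adj G u t
  ... | true  = refl , A*x≢0 ∘ trans (ℚ.*-identityˡ x)
  ... | false = ⊥-elim (A*x≢0 (ℚ.*-zeroˡ x))

  A·≢0⇒neighbour : ∀ {u} (x : Fin n → ℚ) → A G u · x ≢ 0ℚ → ∃ λ t → Adj G u t × x t ≢ 0ℚ
  A·≢0⇒neighbour {u} x Au·x≢0 =
    let t , Aut*xt≢0 = sumℚ≢0⇒term≢0 (λ t → A G u t * x t) Au·x≢0
    in t , A*≢0 u t (x t) Aut*xt≢0

  HasSign-A* : ∀ {s} u t x → HasSign s (A G u t * x) → Adj G u t × HasSign s x
  HasSign-A* {s} u t x sgn with adj G u t
  ... | true  = refl , subst (HasSign s) (ℚ.*-identityˡ x) sgn
  ... | false = ⊥-elim (HasSign⇒≢0 sgn (ℚ.*-zeroˡ x))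

-- Matchings and alternating paths

Edge : ℕ → Set
Edge n = Fin n × Fin n

module _ {n : ℕ} where

  ends : Edge n → List (Fin n)
  ends (u , w) = u ∷ w ∷ []

  Matched : List (Edge n) → Fin n → Fin n → Set
  Matched M u w = (u , w) ∈ M ⊎ (w , u) ∈ M

  Matched-sym : ∀ {M u w} → Matched M u w → Matched M w u
  Matched-sym = Sum.swap

  ∈-ends⇒Saturates : ∀ {M e x} → e ∈ M → x ∈ ends e → Saturates M x
  ∈-ends⇒Saturates (here refl) (here x≡u)         = here x≡u
  ∈-ends⇒Saturates (here refl) (there (here x≡w)) = there (here x≡w)
  ∈-ends⇒Saturates {(_ , _) ∷ _} (there e∈M) x∈e = there (there (∈-ends⇒Saturates e∈M x∈e))

  Matched⇒Saturates : ∀ {M u w} → Matched M u w → Saturates M u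
  Matched⇒Saturates (inj₁ uw∈M) = ∈-ends⇒Saturates uw∈M (here refl)
  Matched⇒Saturates (inj₂ wu∈M) = ∈-ends⇒Saturates wu∈M (there (here refl))

  Saturates⇒Matched : ∀ {M u} → Saturates M u → ∃ (Matched M u)
  Saturates⇒Matched {(_ , w) ∷ _} (here refl)         = w , inj₁ (here refl)
  Saturates⇒Matched {(u , _) ∷ _} (there (here refl)) = u , inj₂ (here refl)
  Saturates⇒Matched {_ ∷ _} (there (there u∈M)) with Saturates⇒Matched u∈M
  ... | w , inj₁ uw∈M = w , inj₁ (there uw∈M)
  ... | w , inj₂ wu∈M = w , inj₂ (there wu∈M)

  edge-unique : ∀ {M e e′ x} → Unique (endpoints M) → e ∈ M → e′ ∈ M →
                x ∈ ends e → x ∈ ends e′ → e ≡ e′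
  edge-unique _ (here refl) (here refl) _ _ = refl
  edge-unique (u∉ ∷ w∉ ∷ _) (here refl) (there e′∈M) x∈e x∈e′ with ∈-ends⇒Saturates e′∈M x∈e′ | x∈e
  ... | x∈M | here refl         = ⊥-elim (All.lookup u∉ (there x∈M) refl)
  ... | x∈M | there (here refl) = ⊥-elim (All.lookup w∉ x∈M refl)
  edge-unique (u∉ ∷ w∉ ∷ _) (there e∈M) (here refl) x∈e x∈e′ with ∈-ends⇒Saturates e∈M x∈e | x∈e′
  ... | x∈M | here refl         = ⊥-elim (All.lookup u∉ (there x∈M) refl)
  ... | x∈M | there (here refl) = ⊥-elim (All.lookup w∉ x∈M refl)
  edge-unique {(_ , _) ∷ _} (_ ∷ _ ∷ U) (there e∈M) (there e′∈M) x∈e x∈e′ =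
    edge-unique U e∈M e′∈M x∈e x∈e′

  mate-unique : ∀ {M u w w′} → Unique (endpoints M) → Matched M u w → Matched M u w′ → w ≡ w′
  mate-unique U (inj₁ m) (inj₁ m′) = cong proj₂ (edge-unique U m m′ (here refl) (here refl))
  mate-unique U (inj₂ m) (inj₂ m′) = cong proj₁ (edge-unique U m m′ (there (here refl)) (there (here refl)))
  mate-unique U (inj₁ m) (inj₂ m′) with edge-unique U m m′ (here refl) (there (here refl))
  ... | refl = refl
  mate-unique U (inj₂ m) (inj₁ m′) with edge-unique U m m′ (there (here refl)) (here refl)
  ... | refl = refl

  transpose-matchˡ : (a x : Fin n) → transpose a x a ≡ x
  transpose-matchˡ a x with a Fin.≟ a
  ... | yes _   = refl
  ... | no  a≢a = ⊥-elim (a≢a refl)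

  transpose-matchʳ : (a x : Fin n) → transpose a x x ≡ a
  transpose-matchʳ a x with x Fin.≟ a
  ... | yes x≡a = x≡a
  ... | no  _   with x Fin.≟ x
  ...   | yes _   = refl
  ...   | no  x≢x = ⊥-elim (x≢x refl)

  transpose-fix : {a x t : Fin n} → t ≢ a → t ≢ x → transpose a x t ≡ t
  transpose-fix {a = a} {x} {t} t≢a t≢x with t Fin.≟ a
  ... | yes t≡a = ⊥-elim (t≢a t≡a)
  ... | no  _   with t Fin.≟ x
  ...   | yes t≡x = ⊥-elim (t≢x t≡x)
  ...   | no  _   = refl

  transpose-involutive : (a x t : Fin n) → transpose a x (transpose a x t) ≡ t
  transpose-involutive a x t with t Fin.≟ a
  ... | yes refl = transpose-matchʳ t x
  ... | no  t≢a  with t Fin.≟ x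
  ...   | yes refl = transpose-matchˡ a t
  ...   | no  t≢x  = transpose-fix t≢a t≢x

  transpose-injective : ∀ a x {s t} → transpose a x s ≡ transpose a x t → s ≡ t
  transpose-injective a x {s} {t} τs≡τt = begin
    s                                 ≡⟨ transpose-involutive a x s ⟨
    transpose a x (transpose a x s)   ≡⟨ cong (transpose a x) τs≡τt ⟩
    transpose a x (transpose a x t)   ≡⟨ transpose-involutive a x t ⟩
    t                                 ∎
    where open ≡-Reasoning

  mapEdge : (Fin n → Fin n) → Edge n → Edge n
  mapEdge f (u , w) = f u , f w

  -- When x is unsaturated, renaming a to x moves the matching edge at a over to x.
  swap : Fin n → Fin n → List (Edge n) → List (Edge n)
  swap a x = map (mapEdge (transpose a x))

  endpoints-map : ∀ f M → endpoints (map (mapEdge f) M) ≡ map f (endpoints M)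
  endpoints-map f []            = refl
  endpoints-map f ((u , w) ∷ M) = cong (λ E → f u ∷ f w ∷ E) (endpoints-map f M)

  swap-Saturates⁻ : ∀ {a x M t} → Saturates (swap a x M) t → Saturates M (transpose a x t)
  swap-Saturates⁻ {a} {x} {M} {t} t∈
    with ∈-map⁻ (transpose a x) (subst (t ∈_) (endpoints-map (transpose a x) M) t∈)
  ... | s , s∈M , refl = subst (_∈ endpoints M) (sym (transpose-involutive a x s)) s∈M

  swap-frees : ∀ {a x M} → ¬ Saturates M x → ¬ Saturates (swap a x M) a
  swap-frees {a} {x} {M} x-free a∈ =
    x-free (subst (Saturates M) (transpose-matchˡ a x) (swap-Saturates⁻ {a} {x} {M} a∈))

  swap-unsaturated : ∀ {a x M t} → t ≢ a → t ≢ x → ¬ Saturates M t → ¬ Saturates (swap a x M) t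
  swap-unsaturated {a} {x} {M} t≢a t≢x t-free t∈ =
    t-free (subst (Saturates M) (transpose-fix t≢a t≢x) (swap-Saturates⁻ {a} {x} {M} t∈))

  swap-Matched : ∀ {a x M s t} → s ≢ a → s ≢ x → t ≢ a → t ≢ x →
                 Matched M s t → Matched (swap a x M) s t
  swap-Matched {a} {x} s≢a s≢x t≢a t≢x = Sum.map (swapped s≢a s≢x t≢a t≢x) (swapped t≢a t≢x s≢a s≢x)
    where
    swapped : ∀ {M s t} → s ≢ a → s ≢ x → t ≢ a → t ≢ x → (s , t) ∈ M → (s , t) ∈ swap a x M
    swapped s≢a s≢x t≢a t≢x st∈M =
      subst (_∈ _) (cong₂ _,_ (transpose-fix s≢a s≢x) (transpose-fix t≢a t≢x)) (∈-map⁺ _ st∈M)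

module _ {n} (G : Graph n) where

  Matched⇒Adj : ∀ {M u w} → IsMatching G M → Matched M u w → Adj G u w
  Matched⇒Adj (adjacent , _) (inj₁ uw∈M) = All.lookup adjacent uw∈M
  Matched⇒Adj (adjacent , _) (inj₂ wu∈M) = Adj-sym G (All.lookup adjacent wu∈M)

  add-edge-isMatching : ∀ {M v t} → IsMatching G M → Adj G v t → ¬ Saturates M v → ¬ Saturates M t →
                        IsMatching G ((v , t) ∷ M)
  add-edge-isMatching (adjacent , U) vt v-free t-free =
    vt ∷ adjacent , (Adj⇒≢ G vt ∷ ¬Any⇒All¬ _ v-free) ∷ ¬Any⇒All¬ _ t-free ∷ U

  swap-isMatching : ∀ {M a b x} → IsMatching G M → Matched M a b → ¬ Saturates M x → Adj G x b →
                    IsMatching G (swap a x M)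
  swap-isMatching {M} {a} {b} {x} isM@(_ , U) ab x-free xb =
    All-map⁺ (All.tabulate (λ {e} → adjacent e)) ,
    subst Unique (sym (endpoints-map (transpose a x) M)) (Unique.map⁺ (transpose-injective a x) U)
    where
    ≢x : ∀ {t w} → Matched M t w → t ≢ x
    ≢x tw refl = x-free (Matched⇒Saturates tw)
    τb≡b : transpose a x b ≡ b
    τb≡b = transpose-fix (Adj⇒≢ G (Adj-sym G (Matched⇒Adj isM ab))) (≢x (Matched-sym ab))
    adjacent-from-a : ∀ {t} → Matched M a t → Adj G (transpose a x a) (transpose a x t)
    adjacent-from-a at with mate-unique U ab at
    ... | refl = subst₂ (Adj G) (sym (transpose-matchˡ a x)) (sym τb≡b) xb
    swapped-adj : ∀ {s t} → Matched M s t → Dec (s ≡ a) → Dec (t ≡ a) →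
                  Adj G (transpose a x s) (transpose a x t)
    swapped-adj st (yes refl) _        = adjacent-from-a st
    swapped-adj st (no _)     (yes refl) = Adj-sym G (adjacent-from-a (Matched-sym st))
    swapped-adj st (no s≢a)   (no t≢a)   =
      subst₂ (Adj G) (sym (transpose-fix s≢a (≢x st))) (sym (transpose-fix t≢a (≢x (Matched-sym st))))
             (Matched⇒Adj isM st)
    adjacent : ∀ e → e ∈ M → Adj G (transpose a x (proj₁ e)) (transpose a x (proj₂ e))
    adjacent (s , t) st∈M = swapped-adj (inj₁ st∈M) (s Fin.≟ a) (t Fin.≟ a)

  -- A path u = u₀ w₀ u₁ w₁ … u_k with u_i w_i ∈ M, w_i u_{i+1} ∈ E(G) and u_k unsaturated;
  -- evens lists the u_i.
  data AltPath (M : List (Edge n)) : Fin n → Set where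
    stop : ∀ {u} → ¬ Saturates M u → AltPath M u
    step : ∀ {u w u′} → Matched M u w → Adj G w u′ → AltPath M u′ → AltPath M u

  evens : ∀ {M u} → AltPath M u → List (Fin n)
  evens {u = u} (stop _)     = u ∷ []
  evens {u = u} (step _ _ p) = u ∷ evens p

  Simple : ∀ {M u} → AltPath M u → Set
  Simple (stop _)                     = ⊤
  Simple {u = u} (step {w = w} _ _ p) = u ∉ evens p × w ∉ evens p × Simple p

  -- Switching the tail first frees u′, after which the edge u w can be moved to u′ w.
  switch : ∀ {M u} → AltPath M u → List (Edge n)
  switch {M} (stop _)                   = M
  switch {u = u} (step {u′ = u′} _ _ p) = swap u u′ (switch p)

  head∈evens : ∀ {M u} (p : AltPath M u) → u ∈ evens p
  head∈evens (stop _)     = here refl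
  head∈evens (step _ _ _) = here refl

  ∉evens-step : ∀ {M u w u′ t} (uw : Matched M u w) (wu′ : Adj G w u′) (p : AltPath M u′) →
                t ∉ evens (step uw wu′ p) → t ≢ u × t ≢ u′ × t ∉ evens p
  ∉evens-step _ _ p t∉ = t∉ ∘ here , (λ { refl → t∉ (there (head∈evens p)) }) , t∉ ∘ there

  length-switch : ∀ {M u} (p : AltPath M u) → length (switch p) ≡ length M
  length-switch (stop _)     = refl
  length-switch (step _ _ p) = trans (length-map _ (switch p)) (length-switch p)

  switch-frees-start : ∀ {M u} (p : AltPath M u) → ¬ Saturates (switch p) u
  switch-frees-start (stop u-free) = u-free
  switch-frees-start (step _ _ p)  = swap-frees {M = switch p} (switch-frees-start p)

  switch-unsaturated : ∀ {M u t} (p : AltPath M u) → t ∉ evens p → ¬ Saturates M t → ¬ Saturates (switch p) t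
  switch-unsaturated (stop _) _ t-free = t-free
  switch-unsaturated (step uw wu′ p) t∉ t-free =
    let t≢u , t≢u′ , t∉p = ∉evens-step uw wu′ p t∉
    in swap-unsaturated {M = switch p} t≢u t≢u′ (switch-unsaturated p t∉p t-free)

  switch-Matched : ∀ {M u s t} (p : AltPath M u) → s ∉ evens p → t ∉ evens p →
                   Matched M s t → Matched (switch p) s t
  switch-Matched (stop _) _ _ st = st
  switch-Matched (step uw wu′ p) s∉ t∉ st =
    let s≢u , s≢u′ , s∉p = ∉evens-step uw wu′ p s∉
        t≢u , t≢u′ , t∉p = ∉evens-step uw wu′ p t∉
    in swap-Matched s≢u s≢u′ t≢u t≢u′ (switch-Matched p s∉p t∉p st)

  switch-isMatching : ∀ {M u} → IsMatching G M → (p : AltPath M u) → Simple p → IsMatching G (switch p)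
  switch-isMatching isM (stop _) _ = isM
  switch-isMatching isM (step uw wu′ p) (u∉ , w∉ , simple) =
    swap-isMatching (switch-isMatching isM p simple) (switch-Matched p u∉ w∉ uw) (switch-frees-start p) (Adj-sym G wu′)

  switch-isMaximum : ∀ {M u} → IsMaximumMatching G M → (p : AltPath M u) → Simple p → IsMaximumMatching G (switch p)
  switch-isMaximum (isM , maximal) p simple =
    switch-isMatching isM p simple ,
    λ M′ isM′ → subst (length M′ ℕ.≤_) (sym (length-switch p)) (maximal M′ isM′)

-- Cycles from duplicate-free lists

module _ {A : Set} where

  lookup-injective : ∀ {xs : List A} → Unique xs → Injective _≡_ _≡_ (lookup xs)
  lookup-injective {_ ∷ _} _         {zero}  {zero}  _  = refl
  lookup-injective {_ ∷ _} (x∉ ∷ _) {zero}  {suc j} x≡ = ⊥-elim (All.lookup x∉ (∈-lookup j) x≡)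
  lookup-injective {_ ∷ _} (x∉ ∷ _) {suc i} {zero}  ≡x = ⊥-elim (All.lookup x∉ (∈-lookup i) (sym ≡x))
  lookup-injective {_ ∷ _} (_ ∷ U)  {suc i} {suc j} eq = cong suc (lookup-injective U eq)

  Linked-lookup : ∀ {R : A → A → Set} {xs} → Linked R xs →
                  ∀ i j → suc (toℕ i) ≡ toℕ j → R (lookup xs i) (lookup xs j)
  Linked-lookup (Rxy ∷ _)  zero    (suc zero)    _  = Rxy
  Linked-lookup (_ ∷ Rxs)  (suc i) (suc j)       eq = Linked-lookup Rxs i j (ℕ.suc-injective eq)
  Linked-lookup [-]        zero    zero          ()
  Linked-lookup (_ ∷ _)    zero    (suc (suc _)) ()
  Linked-lookup (_ ∷ _)    (suc _) zero          ()

  last-lookup : ∀ {xs : List A} {y} → last xs ≡ just y → ∀ j → suc (toℕ j) ≡ length xs → lookup xs j ≡ y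
  last-lookup {_ ∷ []}    refl zero    _  = refl
  last-lookup {_ ∷ _ ∷ _} eq   (suc j) ≡ℓ = last-lookup eq j (ℕ.suc-injective ≡ℓ)

Unique⇒length≤ : ∀ {n} {xs : List (Fin n)} → Unique xs → length xs ℕ.≤ n
Unique⇒length≤ U = injective⇒≤ (lookup-injective U)

lookup-IsCycle : ∀ {n} (G : Graph n) {x xs y} → Unique (x ∷ xs) → Linked (Adj G) (x ∷ xs) →
                 last (x ∷ xs) ≡ just y → Adj G y x → 3 ℕ.≤ length (x ∷ xs) →
                 IsCycle G (length (x ∷ xs)) (lookup (x ∷ xs))
lookup-IsCycle G {x} {xs} U linked last≡y yx 3≤L = 3≤L , lookup-injective U , Linked-lookup linked , closing-edge
  where
  closing-edge : ∀ i j → toℕ i ≡ 0 → suc (toℕ j) ≡ length (x ∷ xs) →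
                 Adj G (lookup (x ∷ xs) j) (lookup (x ∷ xs) i)
  closing-edge zero j _ ≡L = subst (λ t → Adj G t x) (sym (last-lookup last≡y j ≡L)) yx

-- Sign-alternating walks

module SignAlternatingWalk
  {n} (G : Graph n) (c : Fin n → Bool) (proper : ∀ u w → Adj G u w → c u ≢ c w) (c4k-free : C4kFree G)
  {M : List (Edge n)} (isM : IsMatching G M) (z : Fin n → ℚ) (c₀ : Bool)
  (mate-row-zero : ∀ {u w} → c u ≡ c₀ → Matched M u w → A G w · z ≡ 0ℚ)
  where

  open import Data.List.Membership.DecPropositional (Fin._≟_ {n}) using (_∈?_)

  Adj⇒other-colour : ∀ {u w} → c u ≡ c₀ → Adj G u w → c w ≢ c₀
  Adj⇒other-colour cu uw cw = proper _ _ uw (trans cu (sym cw))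

  Adj⇒back-colour : ∀ {w t} → c w ≢ c₀ → Adj G w t → c t ≡ c₀
  Adj⇒back-colour cw wt = trans (¬-not (proper _ _ (Adj-sym G wt))) (sym (¬-not (cw ∘ sym)))

  data Trail : Fin n → Sign → Set where
    start  : ∀ {u s} → c u ≡ c₀ → HasSign s (z u) → Trail u s
    extend : ∀ {u s w u′} → Trail u s → Matched M u w → Adj G w u′ →
             c u′ ≡ c₀ → HasSign (opposite s) (z u′) → Trail u′ (opposite s)

  visited earlier : ∀ {u s} → Trail u s → List (Fin n)
  visited {u} h = u ∷ earlier h
  earlier (start _ _)        = []
  earlier (extend h _ _ _ _) = visited h

  trail-colour : ∀ {u s} → Trail u s → c u ≡ c₀
  trail-colour (start cu _)        = cu
  trail-colour (extend _ _ _ cu _) = cu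

  trail-sign : ∀ {u s} → Trail u s → HasSign s (z u)
  trail-sign (start _ sgn)        = sgn
  trail-sign (extend _ _ _ _ sgn) = sgn

  visited-colour : ∀ {u s t} (h : Trail u s) → t ∈ visited h → c t ≡ c₀
  visited-colour h                  (here refl) = trail-colour h
  visited-colour (extend h _ _ _ _) (there t∈)  = visited-colour h t∈

  closing     : ∀ {u s u′} (h : Trail u s) → Fin n → u′ ∈ visited h → List (Fin n)
  closingTail : ∀ {u s u′} (h : Trail u s) → u′ ∈ visited h → List (Fin n)
  closing {u} h w u′∈ = w ∷ u ∷ closingTail h u′∈
  closingTail h                           (here _)    = []
  closingTail (extend {w = w₀} h _ _ _ _) (there u′∈) = closing h w₀ u′∈

  closing-Linked : ∀ {u s u′ w} (h : Trail u s) (u′∈ : u′ ∈ visited h) → Matched M u w →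
                   Linked (Adj G) (closing h w u′∈)
  closing-Linked h (here _) uw = Adj-sym G (Matched⇒Adj G isM uw) ∷ [-]
  closing-Linked (extend h u₀w₀ w₀u _ _) (there u′∈) uw =
    Adj-sym G (Matched⇒Adj G isM uw) ∷ Adj-sym G w₀u ∷ closing-Linked h u′∈ u₀w₀

  closing-last : ∀ {u s u′ w} (h : Trail u s) (u′∈ : u′ ∈ visited h) → last (closing h w u′∈) ≡ just u′
  closing-last h                           (here refl) = refl
  closing-last (extend {w = w₀} h _ _ _ _) (there u′∈) = closing-last {w = w₀} h u′∈

  closing-members : ∀ {u s u′ w t} (h : Trail u s) (u′∈ : u′ ∈ visited h) → Matched M u w →
                    t ∈ closing h w u′∈ → t ∈ visited h ⊎ ∃ λ x → x ∈ visited h × Matched M x t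
  closing-members h (here _) uw (here refl)         = inj₂ (_ , here refl , uw)
  closing-members h (here _) uw (there (here refl)) = inj₁ (here refl)
  closing-members (extend _ _ _ _ _) (there _) uw (here refl)         = inj₂ (_ , here refl , uw)
  closing-members (extend _ _ _ _ _) (there _) uw (there (here refl)) = inj₁ (here refl)
  closing-members (extend h u₀w₀ _ _ _) (there u′∈) uw (there (there t∈)) =
    Sum.map there (λ { (x , x∈ , xt) → x , there x∈ , xt }) (closing-members h u′∈ u₀w₀ t∈)

  closing-Unique : ∀ {u s u′ w} (h : Trail u s) (u′∈ : u′ ∈ visited h) → Unique (visited h) → Matched M u w →
                   Unique (closing h w u′∈)
  closing-Unique h (here _) _ uw = ((λ w≡u → Adj⇒≢ G (Matched⇒Adj G isM uw) (sym w≡u)) ∷ []) ∷ [] ∷ []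
  closing-Unique {u} {w = w} (extend {w = w₀} h u₀w₀ _ cu _) (there u′∈) (u∉ ∷ U) uw =
    All.tabulate w-fresh ∷ All.tabulate u-fresh ∷ closing-Unique h u′∈ U u₀w₀
    where
    u-fresh : ∀ {t} → t ∈ closing h w₀ u′∈ → u ≢ t
    u-fresh t∈ refl with closing-members h u′∈ u₀w₀ t∈
    ... | inj₁ u∈            = All.lookup u∉ u∈ refl
    ... | inj₂ (x , x∈ , xu) = Adj⇒other-colour (visited-colour h x∈) (Matched⇒Adj G isM xu) cu
    w-fresh : ∀ {t} → t ∈ u ∷ closing h w₀ u′∈ → w ≢ t
    w-fresh (here refl) w≡u = Adj⇒≢ G (Matched⇒Adj G isM uw) (sym w≡u)
    w-fresh (there t∈) refl with closing-members h u′∈ u₀w₀ t∈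
    ... | inj₁ w∈ = Adj⇒other-colour cu (Matched⇒Adj G isM uw) (visited-colour h w∈)
    ... | inj₂ (x , x∈ , xw) with mate-unique (proj₂ isM) (Matched-sym uw) (Matched-sym xw)
    ...   | refl = All.lookup u∉ x∈ refl

  -- Signs alternate along the trail, so a visited vertex carrying the opposite sign lies an odd
  -- number of steps back, and the closed walk through it has length divisible by 4.
  closing-length-opposite : ∀ {u s u′ w} (h : Trail u s) (u′∈ : u′ ∈ visited h) →
                            HasSign (opposite s) (z u′) → 4 ∣ length (closing h w u′∈)
  closing-length-same     : ∀ {u s u′ w} (h : Trail u s) (u′∈ : u′ ∈ visited h) →
                            HasSign s (z u′) → 4 ∣ 2 ℕ.+ length (closing h w u′∈)
  closing-length-opposite h (here refl) sgn = ⊥-elim (HasSign-opposite⇒⊥ (trail-sign h) sgn)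
  closing-length-opposite (extend {s = s₀} {w = w₀} h _ _ _ _) (there u′∈) sgn =
    closing-length-same {w = w₀} h u′∈ (subst (λ s → HasSign s _) (opposite-involutive s₀) sgn)
  closing-length-same h (here refl) _ = ∣-refl
  closing-length-same (extend {w = w₀} h _ _ _ _) (there u′∈) sgn =
    ∣m∣n⇒∣m+n ∣-refl (closing-length-opposite {w = w₀} h u′∈ sgn)

  no-return : ∀ {u s w u′} (h : Trail u s) → Unique (visited h) → Matched M u w → Adj G w u′ →
              u′ ∈ visited h → HasSign (opposite s) (z u′) → ⊥
  no-return {w = w} h U uw wu′ u′∈ sgn = c4k-free (length cycle) (lookup cycle) is-cycle 4∣L
    where
    cycle : List (Fin n)
    cycle = closing h w u′∈
    4∣L : 4 ∣ length cycle
    4∣L = closing-length-opposite {w = w} h u′∈ sgn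
    is-cycle : IsCycle G (length cycle) (lookup cycle)
    is-cycle = lookup-IsCycle G (closing-Unique h u′∈ U uw) (closing-Linked h u′∈ uw) (closing-last {w = w} h u′∈)
                              (Adj-sym G wu′) (ℕ.≤-trans (ℕ.n≤1+n 3) (∣⇒≤ 4∣L))

  next-vertex : ∀ {u s w} → Trail u s → Matched M u w → ∃ λ t → Adj G w t × HasSign (opposite s) (z t)
  next-vertex {u} {s} {w} h uw =
    let t , sgn = sumℚ≡0⇒opposite-term (λ t → A G w t * z t) (mate-row-zero (trail-colour h) uw) u u-term
    in t , HasSign-A* G w t (z t) sgn
    where
    Awu≡1 : A G w u ≡ 1ℚ
    Awu≡1 = A-Adj G (Adj-sym G (Matched⇒Adj G isM uw))
    u-term : HasSign s (A G w u * z u)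
    u-term = subst (HasSign s) (sym (trans (cong (_* z u) Awu≡1) (ℚ.*-identityˡ (z u)))) (trail-sign h)

  record Continuation {u s} (h : Trail u s) : Set where
    field
      path     : AltPath G M u
      simple   : Simple G path
      fresh    : All (λ t → t ∈ visited h → t ≡ u) (evens G path)
      coloured : All (λ t → c t ≡ c₀) (evens G path)

  prepend : ∀ {u s w t} (h : Trail u s) (uw : Matched M u w) (wt : Adj G w t) (ct : c t ≡ c₀)
            (sgn : HasSign (opposite s) (z t)) → t ∉ visited h → Continuation (extend h uw wt ct sgn) →
            Continuation h
  prepend {u} {w = w} h uw wt _ _ t∉ r = record
    { path     = step uw wt path
    ; simple   = u∉ , w∉ , simple
    ; fresh    = (λ _ → refl) ∷ All.map (λ t′-fresh t′∈ → ⊥-elim (t∉ (subst (_∈ visited h) (t′-fresh (there t′∈)) t′∈)))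
                                        fresh
    ; coloured = trail-colour h ∷ coloured
    }
    where
    open Continuation r
    u∉ : u ∉ evens G path
    u∉ u∈ = t∉ (subst (_∈ visited h) (All.lookup fresh u∈ (there (here refl))) (here refl))
    w∉ : w ∉ evens G path
    w∉ w∈ = Adj⇒other-colour (trail-colour h) (Matched⇒Adj G isM uw) (All.lookup coloured w∈)

  continue : ∀ fuel {u s} (h : Trail u s) → Unique (visited h) → n ℕ.< length (visited h) ℕ.+ fuel →
             Continuation h
  continue zero h U bound =
    ⊥-elim (ℕ.<⇒≱ bound (subst (ℕ._≤ n) (sym (ℕ.+-identityʳ _)) (Unique⇒length≤ U)))
  continue (suc fuel) {u} {s} h U bound with u ∈? endpoints M
  ... | no u-free =
    record { path = stop u-free ; simple = tt ; fresh = (λ _ → refl) ∷ [] ; coloured = trail-colour h ∷ [] }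
  ... | yes u-sat with Saturates⇒Matched u-sat
  ... | w , uw with next-vertex h uw
  ... | t , wt , sgn with t ∈? visited h
  ... | yes t∈ = ⊥-elim (no-return h U uw wt t∈ sgn)
  ... | no  t∉ = prepend h uw wt ct sgn t∉ (continue fuel h′ (¬Any⇒All¬ _ t∉ ∷ U) bound′)
    where
    ct : c t ≡ c₀
    ct = Adj⇒back-colour (Adj⇒other-colour (trail-colour h) (Matched⇒Adj G isM uw)) wt
    h′ : Trail t (opposite s)
    h′ = extend h uw wt ct sgn
    bound′ : n ℕ.< length (visited h′) ℕ.+ fuel
    bound′ = subst (n ℕ.<_) (ℕ.+-suc _ fuel) bound

  altPath-from : ∀ {u} → c u ≡ c₀ → z u ≢ 0ℚ →
                 Σ (AltPath G M u) λ p → Simple G p × All (λ t → c t ≡ c₀) (evens G p)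
  altPath-from {u} cu zu≢0 = path , simple , coloured
    where
    sign : ∃ λ s → HasSign s (z u)
    sign = ≢0⇒HasSign zu≢0
    open Continuation (continue n (start cu (proj₂ sign)) ([] ∷ []) (ℕ.n<1+n n))

-- Maximum matchings exist

module _ {A : Set} (elements : List A) where

  listsOfLength : ℕ → List (List A)
  listsOfLength zero    = [] ∷ []
  listsOfLength (suc k) = cartesianProductWith _∷_ elements (listsOfLength k)

  length-∈-listsOfLength : ∀ {k xs} → xs ∈ listsOfLength k → length xs ≡ k
  length-∈-listsOfLength {zero}  (here refl) = refl
  length-∈-listsOfLength {suc k} xs∈ with ∈-cartesianProductWith⁻ _∷_ elements (listsOfLength k) xs∈
  ... | _ , ys , _ , ys∈ , refl = cong suc (length-∈-listsOfLength ys∈)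

  module _ (complete : ∀ x → x ∈ elements) {P : List A → Set} (P? : Decidable P) (P[] : P []) where

    ∈-listsOfLength : ∀ xs → xs ∈ listsOfLength (length xs)
    ∈-listsOfLength []       = here refl
    ∈-listsOfLength (x ∷ xs) = ∈-cartesianProductWith⁺ _∷_ (complete x) (∈-listsOfLength xs)

    longest : ∀ k → (∀ xs → P xs → length xs ℕ.≤ k) →
              Σ (List A) λ xs → P xs × ∀ ys → P ys → length ys ℕ.≤ length xs
    longest k bound with Any.any? P? (listsOfLength k)
    ... | yes some =
      let xs , xs∈ , Pxs = find some
      in xs , Pxs , λ ys Pys → subst (length ys ℕ.≤_) (sym (length-∈-listsOfLength xs∈)) (bound ys Pys)
    longest zero    bound | no none = ⊥-elim (none (here P[]))
    longest (suc k) bound | no none = longest k bound′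
      where
      bound′ : ∀ ys → P ys → length ys ℕ.≤ k
      bound′ ys Pys with ℕ.m≤n⇒m<n∨m≡n (bound ys Pys)
      ... | inj₁ |ys|<1+k = ℕ.≤-pred |ys|<1+k
      ... | inj₂ |ys|≡1+k =
        ⊥-elim (none (lose (subst (λ k → ys ∈ listsOfLength k) |ys|≡1+k (∈-listsOfLength ys)) Pys))

length≤length-endpoints : ∀ {n} (M : List (Edge n)) → length M ℕ.≤ length (endpoints M)
length≤length-endpoints []      = ℕ.z≤n
length≤length-endpoints (_ ∷ M) = ℕ.s≤s (ℕ.m≤n⇒m≤1+n (length≤length-endpoints M))

maximumMatching : ∀ {n} (G : Graph n) → Σ (List (Edge n)) (IsMaximumMatching G)
maximumMatching {n} G = longest allEdges ∈-allEdges isMatching? ([] , []) n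
                                (λ M (_ , U) → ℕ.≤-trans (length≤length-endpoints M) (Unique⇒length≤ U))
  where
  open import Data.List.Relation.Unary.Unique.DecPropositional (Fin._≟_ {n}) using (unique?)
  allEdges : List (Edge n)
  allEdges = cartesianProduct (allFin n) (allFin n)
  ∈-allEdges : ∀ e → e ∈ allEdges
  ∈-allEdges (u , w) = ∈-cartesianProduct⁺ (∈-allFin u) (∈-allFin w)
  isMatching? : Decidable (IsMatching G)
  isMatching? M = All.all? (λ { (u , w) → adj G u w Bool.≟ true }) M ×-dec unique? (endpoints M)

-- Supports and unsaturated vertices

module _ {n} (G : Graph n) (c : Fin n → Bool) (proper : ∀ u w → Adj G u w → c u ≢ c w) (c4k-free : C4kFree G)
  where

  InSupp⇒maximum-avoiding : ∀ {v} → InSupp G v →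
                            Σ (List (Edge n)) λ M → IsMaximumMatching G M × ¬ Saturates M v
  InSupp⇒maximum-avoiding {v} (x , x∈Null , xv≢0) =
    let M , isMax = maximumMatching G
        open SignAlternatingWalk G c proper c4k-free (proj₁ isMax) x (c v) (λ _ _ → x∈Null _)
        p , simple , _ = altPath-from refl xv≢0
    in switch G p , switch-isMaximum G isMax p simple , switch-frees-start G p

  obstruction⇒InSupp : ∀ {v} → Obstruction (A G) (δ v) → InSupp G v
  obstruction⇒InSupp {v} (l , l⊥A , l·δ≢0) = l , l∈Null , l·δ≢0 ∘ trans (·-δ l v)
    where
    l∈Null : InNull G l
    l∈Null i = trans (·-comm (A G i) l) (trans (sumℚ-cong (λ j → cong (l j *_) (A-sym G i j))) (l⊥A i))

  solution⇒larger-matching : ∀ {M v} → IsMatching G M → ¬ Saturates M v → Solution (A G) (δ v) →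
                             Σ (List (Edge n)) λ M′ → IsMatching G M′ × length M′ ≡ suc (length M)
  solution⇒larger-matching {M} {v} isM v-free (y , Ay≡δ)
    with A·≢0⇒neighbour G y (ℚ.1≢0 ∘ trans (sym (trans (Ay≡δ v) (δ-diag v))))
  ... | t , vt , yt≢0 =
    (v , t) ∷ switch G p ,
    add-edge-isMatching G (switch-isMatching G isM p simple) vt v-free′ (switch-frees-start G p) ,
    cong suc (length-switch G p)
    where
    mate-row-zero : ∀ {u w} → c u ≡ not (c v) → Matched M u w → A G w · y ≡ 0ℚ
    mate-row-zero {w = w} _ uw =
      trans (Ay≡δ w) (δ-off {j = v} {k = w} (λ { refl → v-free (Matched⇒Saturates (Matched-sym uw)) }))
    open SignAlternatingWalk G c proper c4k-free isM y (not (c v)) mate-row-zero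
    path : Σ (AltPath G M t) λ p → Simple G p × All (λ u → c u ≡ not (c v)) (evens G p)
    path = altPath-from (¬-not (proper t v (Adj-sym G vt))) yt≢0
    p : AltPath G M t
    p = proj₁ path
    simple : Simple G p
    simple = proj₁ (proj₂ path)
    v∉p : v ∉ evens G p
    v∉p v∈ = not-¬ refl (All.lookup (proj₂ (proj₂ path)) v∈)
    v-free′ : ¬ Saturates (switch G p) v
    v-free′ = switch-unsaturated G p v∉p v-free

  maximum-avoiding⇒InSupp : ∀ {v} → Σ (List (Edge n)) (λ M → IsMaximumMatching G M × ¬ Saturates M v) →
                            InSupp G v
  maximum-avoiding⇒InSupp {v} (M , (isM , maximal) , v-free) with fredholm (A G) (δ v)
  ... | inj₂ obstruction = obstruction⇒InSupp obstruction
  ... | inj₁ solution =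
    let M′ , isM′ , |M′|≡1+|M| = solution⇒larger-matching isM v-free solution
    in ⊥-elim (ℕ.<-irrefl refl (subst (ℕ._≤ length M) |M′|≡1+|M| (maximal M′ isM′)))

theorem2p11 : ∀ {n : ℕ} (G : Graph n) → Bipartite G → C4kFree G → (v : Fin n) →
    InSupp G v ⇔ Σ (List (Fin n × Fin n)) (λ M → IsMaximumMatching G M × ¬ Saturates M v)
theorem2p11 G (c , proper) c4k-free v =
  mk⇔ (InSupp⇒maximum-avoiding G c proper c4k-free) (maximum-avoiding⇒InSupp G c proper c4k-free)
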